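{- For every $n\ge 3$, the hypercube graph $Q_n$ satisfies $\operatorname{nim}(\mathrm{TER}(Q_n))=0$.
   Context: $Q_n$ is the graph whose vertices are the binary strings of length $n$, two of them being adjacent exactly when they differ in a single digit. For a graph $G$ with vertex set $V$, a set $K\subseteq V$ is convex if it contains every vertex lying on any shortest path between two elements of $K$. The convex hull $[P]$ of $P\subseteq V$ is the smallest convex set containing $P$. The game $\mathrm{TER}(G)$: positions are the sets $P\subseteq V$ reachable from the starting position $\emptyset$ by the following moves. If $[V\setminus P]=V$, then the options of $P$ are all sets $P\cup\{v\}$ with $v\in V\setminus P$; if $[V\setminus P]\neq V$, then $P$ is terminal (has no options). The nim-value of a position is defined recursively by $\operatorname{nim}(p)=\operatorname{mex}\{\operatorname{nim}(q): q\text{ an option of }p\}$, where $\operatorname{mex}(A)$ is the smallest nonnegative integer not in $A$; the nim-value of a game is that of its starting position. -}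

module Defs where

open import Level using (Level; _⊔_; 0ℓ) renaming (suc to lsuc)
open import Data.Bool.Base using (Bool)
open import Data.Empty using (⊥-elim)
open import Data.List.Base using (List; []; _∷_)
open import Data.List.Membership.Propositional using () renaming (_∈_ to _∈ₗ_)
open import Data.List.Relation.Unary.Unique.Propositional using (Unique)
open import Data.Nat.Base using (ℕ; zero; suc; _≤_; _<_)
open import Data.Nat.Properties using (<-cmp)
open import Data.Product using (∃; ∃!; ∃₂; _×_; _,_)
open import Data.Vec.Base using (Vec; lookup)
open import Function.Base using (_∘_)
open import Relation.Binary.Construct.Closure.ReflexiveTransitive using (Star; ε; _◅_)
open import Relation.Binary.Core using (Rel)
open import Relation.Binary.Definitions using (Symmetric; tri<; tri≈; tri>)
open import Relation.Binary.PropositionalEquality using (_≡_; _≢_; refl; sym; trans; subst)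
open import Relation.Nullary.Negation using (¬_)
open import Relation.Unary using (Pred; _∈_; _∉_; _⊆_; _≐_; ∅; U; ∁; _∪_; ｛_｝)

record Graph : Set₁ where
  field
    Vertex : Set
    _~_    : Rel Vertex 0ℓ
    ~-sym    : Symmetric _~_
    ~-irrefl : ∀ {x} → ¬ (x ~ x)

module _ (G : Graph) where
  open Graph G

  Walk : Rel Vertex 0ℓ
  Walk = Star _~_

  vertices : ∀ {x y} → Walk x y → List Vertex
  vertices {x} ε       = x ∷ []
  vertices {x} (_ ◅ w) = x ∷ vertices w

  length : ∀ {x y} → Walk x y → ℕ
  length ε       = zero
  length (_ ◅ w) = suc (length w)

  IsPath : ∀ {x y} → Walk x y → Set
  IsPath w = Unique (vertices w)

  IsShortestPath : ∀ {x y} → Walk x y → Set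
  IsShortestPath {x} {y} w =
    IsPath w × (∀ (w′ : Walk x y) → IsPath w′ → length w ≤ length w′)

  Convex : ∀ {ℓ} → Pred Vertex ℓ → Set ℓ
  Convex K = ∀ {x y z} → x ∈ K → y ∈ K →
             (w : Walk x y) → IsShortestPath w → z ∈ₗ vertices w → z ∈ K

  -- The smallest convex set containing S, generated inductively.
  -- Hull-⊇, Hull-convex and Hull-least show that it is that set.
  data Hull {ℓ} (S : Pred Vertex ℓ) : Pred Vertex ℓ where
    base  : ∀ {x} → x ∈ S → x ∈ Hull S
    close : ∀ {x y z} → x ∈ Hull S → y ∈ Hull S →
            (w : Walk x y) → IsShortestPath w → z ∈ₗ vertices w → z ∈ Hull S

  Hull-⊇ : ∀ {ℓ} {S : Pred Vertex ℓ} → S ⊆ Hull S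
  Hull-⊇ = base

  Hull-convex : ∀ {ℓ} {S : Pred Vertex ℓ} → Convex (Hull S)
  Hull-convex = close

  Hull-least : ∀ {ℓ ℓ′} {S : Pred Vertex ℓ} {K : Pred Vertex ℓ′} →
               Convex K → S ⊆ K → Hull S ⊆ K
  Hull-least cK S⊆K (base x∈S)          = S⊆K x∈S
  Hull-least cK S⊆K (close hx hy w s z∈w) =
    cK (Hull-least cK S⊆K hx) (Hull-least cK S⊆K hy) w s z∈w

-- Position may contain elements not reachable from start through Option;
-- these have no influence on the nim-value of start.
record Game (a b : Level) : Set (lsuc (a ⊔ b)) where
  field
    Position : Set a
    start    : Position
    Option   : Position → Position → Set b   -- Option p q: q is an option of p

IsMex : ∀ {ℓ} → Pred ℕ ℓ → ℕ → Set ℓ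
IsMex A k = k ∉ A × (∀ {j} → j < k → j ∈ A)

module _ {a b} (Γ : Game a b) where
  open Game Γ

  -- NimValue p k is the graph of the recursion nim p = mex { nim q : Option p q }.
  -- Here v assigns to every option its nim-value; keeping v explicit makes the
  -- definition strictly positive.
  data NimValue (p : Position) (k : ℕ) : Set (a ⊔ b) where
    mex : (v : ∀ {q} → Option p q → ℕ) →
          (∀ {q} (o : Option p q) → NimValue q (v o)) →
          IsMex (λ m → ∃₂ λ q (o : Option p q) → v o ≡ m) k →
          NimValue p k

  NimValue-unique : ∀ {p j k} → NimValue p j → NimValue p k → j ≡ k
  NimValue-unique {j = j} {k} (mex v nv (j∉ , <j)) (mex v′ nv′ (k∉ , <k)) with <-cmp j k
  ... | tri≈ _ j≡k _ = j≡k
  ... | tri< j<k _ _ with q , o , e ← <k j<k =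
        ⊥-elim (j∉ (q , o , trans (NimValue-unique (nv o) (nv′ o)) e))
  ... | tri> _ _ k<j with q , o , e ← <j k<j =
        ⊥-elim (k∉ (q , o , trans (sym (NimValue-unique (nv o) (nv′ o))) e))

GameNimValue : ∀ {a b} → Game a b → ℕ → Set (a ⊔ b)
GameNimValue Γ = NimValue Γ (Game.start Γ)

module _ (G : Graph) where
  open Graph G

  data TEROption (P : Pred Vertex 0ℓ) : Pred Vertex 0ℓ → Set₁ where
    select : Hull G (∁ P) ≐ U → ∀ {v} → v ∉ P → TEROption P (P ∪ ｛ v ｝)

  TER : Game (lsuc 0ℓ) (lsuc 0ℓ)
  TER = record { Position = Pred Vertex 0ℓ ; start = ∅ ; Option = TEROption }

Q : ℕ → Graph
Q n = record
  { Vertex   = Vec Bool n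
  ; _~_      = λ x y → ∃! _≡_ λ i → lookup x i ≢ lookup y i
  ; ~-sym    = λ (i , d , u) → i , d ∘ sym , λ d′ → u (d′ ∘ sym)
  ; ~-irrefl = λ (_ , d , _) → d refl
  }

{-# OPTIONS --safe #-}
module Submission where

-- Convex sets in Q_n are subcubes, so the game ends exactly when the selected set
-- contains a facet {x | x_i = c}.  The second player answers every move v with the
-- vertex obtained from v by flipping the first coordinate.  Facets in the other
-- directions are unions of such pairs, so the first player never completes one; and
-- if v were the last unselected vertex of a facet in the first direction, then only v
-- and its mate would be unselected, and since they agree in the second coordinate
-- the game would already have been over.

open import Defs
open import Level using (0ℓ)
open import Algebra.Properties.CommutativeSemigroup using (interchange)
open import Data.Bool.Base using (Bool; true; false; not; if_then_else_)
open import Data.Bool.Properties using (not-involutive; not-¬; ¬-not) renaming (_≟_ to _≟ᵇ_)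
open import Data.Fin.Base using (Fin; zero; suc)
open import Data.Fin.Properties using (all?; suc-injective) renaming (_≟_ to _≟ᶠ_)
open import Data.List.Base as List using (List; []; _∷_)
open import Data.List.Extrema.Nat using (max; xs≤max)
open import Data.List.Membership.Propositional using (find; lose) renaming (_∈_ to _∈ₗ_; _∉_ to _∉ₗ_)
open import Data.List.Membership.Propositional.Properties
  using (∈-filter⁺; ∈-map⁺; ∈-cartesianProductWith⁺; ∈-allFin)
open import Data.List.Properties using (filter-notAll)
open import Data.List.Relation.Unary.All as All using ([]; _∷_)
open import Data.List.Relation.Unary.AllPairs using ([]; _∷_)
open import Data.List.Relation.Unary.Any as Any using (here; there)
open import Data.Nat.Base using (ℕ; zero; suc; _+_; _≤_; _<_; _≥_; z≤n; s≤s; s≤s⁻¹)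
open import Data.Nat.Induction using (Acc; acc; <-wellFounded)
open import Data.Nat.Properties
  using (≤-refl; ≤-reflexive; ≤-trans; <⇒≱; n<1+n; m≤n⇒m<n∨m≡n; m≤m+n; m≤n+m;
         +-mono-≤; +-monoˡ-≤; +-monoʳ-≤; +-assoc; +-identityʳ; +-cancelˡ-≤; +-cancelʳ-≤;
         +-commutativeSemigroup; module ≤-Reasoning)
  renaming (_≟_ to _≟ⁿ_)
open import Data.Product using (∃; ∃₂; _×_; _,_; proj₁; proj₂)
open import Data.Sum.Base using (_⊎_; inj₁; inj₂)
open import Data.Unit.Base using (tt)
open import Data.Vec.Base using (Vec; []; _∷_; lookup; tabulate; replicate)
open import Data.Vec.Properties using (lookup∘tabulate; tabulate∘lookup; tabulate-cong; lookup-replicate; ≡-dec)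
open import Function.Base using (_∘_)
open import Relation.Binary.Construct.Closure.ReflexiveTransitive using (ε; _◅_; _◅◅_; gmap)
open import Relation.Binary.Definitions using (DecidableEquality)
open import Relation.Binary.PropositionalEquality
  using (_≡_; _≢_; refl; sym; trans; cong; cong₂; subst)
open import Relation.Nullary using (Dec; yes; no; does; ¬?; contradiction)
open import Relation.Nullary.Decidable using (map′; _×-dec_; decidable-stable)
open import Relation.Unary using (Pred; Decidable; _∈_; _∉_; _⊆_; _≐_; U; ∁; _∪_; ｛_｝)
open import Relation.Unary.Properties using (_∪?_)

-- Existence of nim-values

-- The search for the least number outside `A` cannot pass `N`; decidability makes each test
-- constructive.
IsMex-exists : ∀ {ℓ} {A : Pred ℕ ℓ} → Decidable A → ∀ {N} → N ∉ A → ∃ (IsMex A)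
IsMex-exists {A = A} A? {N} N∉A with search (suc N)
  where
  search : ∀ n → (∀ {j} → j < n → j ∈ A) ⊎ ∃ (IsMex A)
  search zero = inj₁ λ ()
  search (suc n) with search n
  ... | inj₂ m = inj₂ m
  ... | inj₁ below with A? n
  ...   | no n∉A = inj₂ (n , n∉A , below)
  ...   | yes n∈A = inj₁ λ j<1+n → case-≤ (m≤n⇒m<n∨m≡n (s≤s⁻¹ j<1+n))
    where
    case-≤ : ∀ {j} → j < n ⊎ j ≡ n → j ∈ A
    case-≤ (inj₁ j<n) = below j<n
    case-≤ (inj₂ refl) = n∈A
... | inj₁ below = contradiction (below (n<1+n N)) N∉A
... | inj₂ m = m

module _ (G : Graph) (_≟_ : DecidableEquality (Graph.Vertex G))
         {vs : List (Graph.Vertex G)} (∈vs : ∀ v → v ∈ₗ vs)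
         (spanning? : ∀ {P : Pred (Graph.Vertex G) 0ℓ} → Decidable P → Dec (Hull G (∁ P) ≐ U))
         where

  -- `NimValue` is a relation, so a value has to be constructed; the pairing argument only shows
  -- that any value of a symmetric position is 0. The recursion is on the length of a list covering
  -- the unselected vertices.
  NimValue-exists : ∀ {P} → Decidable P → ∃ (NimValue (TER G) P)
  NimValue-exists P? = go P? (<-wellFounded _) λ {v} _ → ∈vs v
    where
    go : ∀ {P L} → Decidable P → Acc _<_ (List.length L) → ∁ P ⊆ (_∈ₗ L) →
         ∃ (NimValue (TER G) P)
    go {P} {L} P? (acc rs) ∁P⊆L =
      _ , mex value (λ { (select _ v∉P) → value-correct v∉P }) (proj₂ mex-value)
      where
      after : ∀ {v} → v ∉ P → ∃ (NimValue (TER G) (P ∪ ｛ v ｝))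
      -- Filtering `v` out of `L` strictly shortens it, since `v ∉ P` puts `v` in `L`.
      after {v} v∉P = go (P? ∪? (v ≟_))
        (rs (filter-notAll (λ x → ¬? (v ≟ x)) L (Any.map (λ v≡x v≢x → v≢x v≡x) (∁P⊆L v∉P))))
        λ x∉ → ∈-filter⁺ (λ x → ¬? (v ≟ x)) (∁P⊆L (x∉ ∘ inj₁)) (x∉ ∘ inj₂)

      -- The value 0 at selected vertices is junk.
      valueAt : Graph.Vertex G → ℕ
      valueAt v with P? v
      ... | yes _ = 0
      ... | no v∉P = proj₁ (after v∉P)

      value-correct : ∀ {v} → v ∉ P → NimValue (TER G) (P ∪ ｛ v ｝) (valueAt v)
      value-correct {v} v∉P with P? v
      ... | yes v∈P = contradiction v∈P v∉P
      ... | no v∉P′ = proj₂ (after v∉P′)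

      -- This depends only on the vertex, not on the proofs inside `select`, so a finite search
      -- through `vs` decides which values occur.
      value : ∀ {q} → TEROption G P q → ℕ
      value (select _ {v} _) = valueAt v

      Values : Pred ℕ _
      Values m = ∃₂ λ q (o : TEROption G P q) → value o ≡ m

      values? : Decidable Values
      values? m = map′
        (λ { (h , any) →
               let _ , _ , v∉P , e = find {P = λ v → v ∉ P × valueAt v ≡ m} any in
               _ , select h v∉P , e })
        (λ { (_ , select h {v} v∉P , e) → h , lose (∈vs v) (v∉P , e) })
        (spanning? P? ×-dec Any.any? (λ v → ¬? (P? v) ×-dec (valueAt v ≟ⁿ m)) vs)

      -- The maximum includes the junk values, which can only raise the bound.
      bound : ℕ
      bound = max 0 (List.map valueAt vs)

      bound∉ : suc bound ∉ Values
      bound∉ (_ , select _ {v} _ , e) =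
        <⇒≱ (n<1+n bound)
          (subst (_≤ bound) e (All.lookup (xs≤max 0 (List.map valueAt vs)) (∈-map⁺ valueAt (∈vs v))))

      mex-value : ∃ (IsMex Values)
      mex-value = IsMex-exists values? bound∉

-- Hamming distance and geodesics in the hypercube

δ : Bool → Bool → ℕ
δ false false = 0
δ false true  = 1
δ true  false = 1
δ true  true  = 0

δ-refl : ∀ a → δ a a ≡ 0
δ-refl false = refl
δ-refl true  = refl

δ-≢ : ∀ {a b} → a ≢ b → δ a b ≡ 1
δ-≢ {false} {false} a≢b = contradiction refl a≢b
δ-≢ {false} {true}  _   = refl
δ-≢ {true}  {false} _   = refl
δ-≢ {true}  {true}  a≢b = contradiction refl a≢b

δ≡0 : ∀ {a b} → δ a b ≤ 0 → b ≡ a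
δ≡0 {false} {false} _ = refl
δ≡0 {true}  {true}  _ = refl

δ-triangle : ∀ a b c → δ a c ≤ δ a b + δ b c
δ-triangle false _     false = z≤n
δ-triangle false false true  = s≤s z≤n
δ-triangle false true  true  = s≤s z≤n
δ-triangle true  false false = s≤s z≤n
δ-triangle true  true  false = s≤s z≤n
δ-triangle true  _     true  = z≤n

δ-between : ∀ a b c → b ≡ a ⊎ b ≡ c → δ a b + δ b c ≤ δ a c
δ-between a _ c (inj₁ refl) = ≤-reflexive (cong (_+ δ a c) (δ-refl a))
δ-between a b _ (inj₂ refl) = ≤-reflexive (trans (cong (δ a b +_) (δ-refl b)) (+-identityʳ _))

dist : ∀ {n} → Vec Bool n → Vec Bool n → ℕ
dist []      []      = 0
dist (a ∷ x) (b ∷ y) = δ a b + dist x y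

dist-refl : ∀ {n} (x : Vec Bool n) → dist x x ≡ 0
dist-refl []      = refl
dist-refl (a ∷ x) = cong₂ _+_ (δ-refl a) (dist-refl x)

+-interchange : ∀ a b c d → (a + b) + (c + d) ≡ (a + c) + (b + d)
+-interchange = interchange +-commutativeSemigroup

dist-triangle : ∀ {n} (x y z : Vec Bool n) → dist x z ≤ dist x y + dist y z
dist-triangle []      []      []      = z≤n
dist-triangle (a ∷ x) (b ∷ y) (c ∷ z) = ≤-trans
  (+-mono-≤ (δ-triangle a b c) (dist-triangle x y z))
  (≤-reflexive (+-interchange (δ a b) (δ b c) (dist x y) (dist y z)))

dist-between : ∀ {n} (x y z : Vec Bool n) →
               (∀ i → lookup y i ≡ lookup x i ⊎ lookup y i ≡ lookup z i) →
               dist x y + dist y z ≤ dist x z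
dist-between []      []      []      _   = z≤n
dist-between (a ∷ x) (b ∷ y) (c ∷ z) btw = ≤-trans
  (≤-reflexive (+-interchange (δ a b) (dist x y) (δ b c) (dist y z)))
  (+-mono-≤ (δ-between a b c (btw zero)) (dist-between x y z (btw ∘ suc)))

-- Equality in the triangle inequality for a sum forces it in each summand: cancelling the
-- inequality of the tails leaves equality at the head, and vice versa.
lookup-between : ∀ {n} (x y z : Vec Bool n) → dist x y + dist y z ≤ dist x z →
                 ∀ i → lookup x i ≡ lookup z i → lookup y i ≡ lookup x i
lookup-between (a ∷ x) (b ∷ y) (c ∷ z) le = go
  where
  le′ : (δ a b + δ b c) + (dist x y + dist y z) ≤ δ a c + dist x z
  le′ = subst (_≤ δ a c + dist x z) (+-interchange (δ a b) (dist x y) (δ b c) (dist y z)) le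

  head-le : δ a b + δ b c ≤ δ a c
  head-le = +-cancelʳ-≤ (dist x y + dist y z) _ _
    (≤-trans le′ (+-monoʳ-≤ (δ a c) (dist-triangle x y z)))

  go : ∀ i → lookup (a ∷ x) i ≡ lookup (c ∷ z) i → lookup (b ∷ y) i ≡ lookup (a ∷ x) i
  go zero refl = δ≡0 (≤-trans (m≤m+n _ _) (≤-trans head-le (≤-reflexive (δ-refl a))))
  go (suc i) = lookup-between x y z (+-cancelˡ-≤ (δ a b + δ b c) _ _
    (≤-trans le′ (+-monoˡ-≤ (dist x z) (δ-triangle a b c)))) i

lookup-ext : ∀ {a} {A : Set a} {n} {x y : Vec A n} → (∀ i → lookup x i ≡ lookup y i) → x ≡ y
lookup-ext {x = x} {y} eq =
  trans (sym (tabulate∘lookup x)) (trans (tabulate-cong eq) (tabulate∘lookup y))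

module _ {n : ℕ} where
  open Graph (Q n) public using () renaming (_~_ to _~Q_)

~Q-∷ : ∀ {n} (b : Bool) {x y : Vec Bool n} → x ~Q y → (b ∷ x) ~Q (b ∷ y)
~Q-∷ b (i , x≢y , unique) =
  suc i , x≢y , λ { {zero} b≢b → contradiction refl b≢b ; {suc j} d → cong suc (unique d) }

~Q-flip : ∀ {n a b} {x : Vec Bool n} → a ≢ b → (a ∷ x) ~Q (b ∷ x)
~Q-flip a≢b = zero , a≢b , λ { {zero} _ → refl ; {suc j} d → contradiction refl d }

dist-~Q : ∀ {n} (x y : Vec Bool n) → x ~Q y → dist x y ≤ 1
dist-~Q (a ∷ x) (b ∷ y) (zero , a≢b , unique)
  -- A difference in the tails would, by uniqueness, have index `zero`; hence the tails coincide.
  rewrite lookup-ext {x = x} {y} (λ i → decidable-stable (_ ≟ᵇ _) λ d → contradiction (unique {suc i} d) λ ())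
        | δ-≢ a≢b | dist-refl y = ≤-refl
dist-~Q (a ∷ x) (b ∷ y) (suc i , d , unique)
  rewrite decidable-stable (a ≟ᵇ b) (λ a≢b → contradiction (unique {zero} a≢b) λ ()) | δ-refl b =
  dist-~Q x y (i , d , λ d′ → suc-injective (unique d′))

module _ {n : ℕ} where

  length-◅◅ : ∀ {x y z} (v : Walk (Q n) x y) (w : Walk (Q n) y z) →
              length (Q n) (v ◅◅ w) ≡ length (Q n) v + length (Q n) w
  length-◅◅ ε       w = refl
  length-◅◅ (e ◅ v) w = cong suc (length-◅◅ v w)

  -- Each edge adds at most 1 to a distance, so the triangle inequality applies edge by edge until
  -- `z` is reached; from there `dist≤length` bounds the rest.
  dist-via : ∀ {x y z} (w : Walk (Q n) x y) → z ∈ₗ vertices (Q n) w →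
             dist x z + dist z y ≤ length (Q n) w
  dist≤length : ∀ {x y} (w : Walk (Q n) x y) → dist x y ≤ length (Q n) w

  dist-via {x} ε (here refl) = ≤-reflexive (cong₂ _+_ (dist-refl x) (dist-refl x))
  dist-via {x} {y} (e ◅ w) (here refl) =
    subst (λ k → k + dist x y ≤ suc (length (Q n) w)) (sym (dist-refl x)) (dist≤length {x} {y} (e ◅ w))
  dist-via {x} {y} {z} (_◅_ {j = x′} e w) (there z∈w) = begin
    dist x z + dist z y                ≤⟨ +-monoˡ-≤ _ (dist-triangle x x′ z) ⟩
    (dist x x′ + dist x′ z) + dist z y ≡⟨ +-assoc (dist x x′) _ _ ⟩
    dist x x′ + (dist x′ z + dist z y) ≤⟨ +-mono-≤ (dist-~Q x x′ e) (dist-via w z∈w) ⟩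
    suc (length (Q n) w)               ∎
    where open ≤-Reasoning

  dist≤length {x} ε = ≤-reflexive (dist-refl x)
  dist≤length {x} {y} (_◅_ {j = x′} e w) =
    ≤-trans (dist-triangle x x′ y) (+-mono-≤ (dist-~Q x x′ e) (dist≤length w))

  geodesic⇒path : ∀ {x y} (w : Walk (Q n) x y) → length (Q n) w ≤ dist x y → IsPath (Q n) w
  geodesic⇒path ε _ = [] ∷ []
  geodesic⇒path {x} {y} (_◅_ {j = x′} e w) le =
    -- If `x` recurred in `w`, then `w` alone would have length at least `dist x y`, although
    -- `e ◅ w` is assumed to be no longer than that.
    All.tabulate (λ { z∈w refl →
      <⇒≱ le (≤-trans (m≤n+m _ (dist x′ x)) (dist-via w z∈w)) })
    ∷ geodesic⇒path w (s≤s⁻¹ (≤-trans le (≤-trans (dist-triangle x x′ y) (+-monoˡ-≤ _ (dist-~Q x x′ e)))))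

  geodesic⇒shortest : ∀ {x y} (w : Walk (Q n) x y) → length (Q n) w ≤ dist x y →
                      IsShortestPath (Q n) w
  geodesic⇒shortest w le = geodesic⇒path w le , λ w′ _ → ≤-trans le (dist≤length w′)

  ∈-vertices-◅◅ : ∀ {x y z} (v : Walk (Q n) x y) (w : Walk (Q n) y z) →
                  y ∈ₗ vertices (Q n) (v ◅◅ w)
  ∈-vertices-◅◅ ε       ε       = here refl
  ∈-vertices-◅◅ ε       (_ ◅ _) = here refl
  ∈-vertices-◅◅ (_ ◅ v) w       = there (∈-vertices-◅◅ v w)

length-gmap-∷ : ∀ {n} b {x y : Vec Bool n} (w : Walk (Q n) x y) →
                length (Q (suc n)) (gmap (b ∷_) (~Q-∷ b) w) ≡ length (Q n) w
length-gmap-∷ b ε       = refl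
length-gmap-∷ b (_ ◅ w) = cong suc (length-gmap-∷ b w)

geodesic : ∀ {n} (x y : Vec Bool n) → ∃ λ (w : Walk (Q n) x y) → length (Q n) w ≡ dist x y
geodesic [] [] = ε , refl
geodesic (a ∷ x) (b ∷ y) with geodesic x y | a ≟ᵇ b
... | w , eq | yes refl = gmap (a ∷_) (~Q-∷ a) w ,
  trans (length-gmap-∷ a w) (trans eq (cong (_+ dist x y) (sym (δ-refl a))))
... | w , eq | no a≢b = ~Q-flip a≢b ◅ gmap (b ∷_) (~Q-∷ b) w ,
  trans (cong suc (trans (length-gmap-∷ b w) eq)) (cong (_+ dist x y) (sym (δ-≢ a≢b)))

-- Hulls and facets

-- By `dist-between`, geodesics from `x` to `y` and from `y` to `z` join to a shortest path, which
-- passes through `y`.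
Convex-between : ∀ {ℓ n} {K : Pred (Vec Bool n) ℓ} → Convex (Q n) K →
                 ∀ {x y z} → x ∈ K → z ∈ K →
                 (∀ i → lookup y i ≡ lookup x i ⊎ lookup y i ≡ lookup z i) → y ∈ K
Convex-between {n = n} cK {x} {y} {z} x∈K z∈K btw with geodesic x y | geodesic y z
... | v , ∣v∣ | w , ∣w∣ = cK x∈K z∈K (v ◅◅ w)
  (geodesic⇒shortest (v ◅◅ w) (≤-trans
    (≤-reflexive (trans (length-◅◅ v w) (cong₂ _+_ ∣v∣ ∣w∣)))
    (dist-between x y z btw)))
  (∈-vertices-◅◅ v w)

-- A vertex on a shortest path splits the distance of its ends exactly, so `lookup-between`
-- preserves any coordinate on which the ends agree.
Facet-convex : ∀ {n} (i : Fin n) (c : Bool) → Convex (Q n) (λ x → lookup x i ≡ c)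
Facet-convex i c {x} {y} {z} xᵢ≡c yᵢ≡c w (path , shortest) z∈w =
  trans (lookup-between x z y via i (trans xᵢ≡c (sym yᵢ≡c))) xᵢ≡c
  where
  via : dist x z + dist z y ≤ dist x y
  via with geodesic x y
  -- Minimality of `w` is against paths only, so the geodesic `g` is first shown to be one.
  ... | g , ∣g∣ = ≤-trans (dist-via w z∈w)
    (≤-trans (shortest g (geodesic⇒path g (≤-reflexive ∣g∣))) (≤-reflexive ∣g∣))

-- For `S = ∁ P` this says that no facet is fully selected: the combinatorial form of a non-terminal
-- position in positive dimension.
MeetsFacets : ∀ {ℓ n} → Pred (Vec Bool n) ℓ → Set ℓ
MeetsFacets {n = n} S = ∀ (i : Fin n) (c : Bool) → ∃ λ v → lookup v i ≡ c × v ∈ S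

meetsFacets⇒spanning : ∀ {ℓ n} {S : Pred (Vec Bool (suc n)) ℓ} →
                       MeetsFacets S → Hull (Q (suc n)) S ≐ U
meetsFacets⇒spanning {n = n} {S} meets =
  (λ _ → tt) , λ {y} _ → subcube (List.allFin _) y λ i i∉ → contradiction (∈-allFin i) i∉
  where
  open import Data.List.Membership.DecPropositional (_≟ᶠ_ {suc n}) using (_∈?_)

  -- Positive dimension supplies a facet in which to find a starting vertex; in dimension 0 the
  -- assumption is vacuous, even for empty `S`.
  x : Vec Bool (suc n)
  x = proj₁ (meets zero true)

  -- If the hull contains the subcube through x with free coordinates J, and z ∈ S
  -- differs from x at i, then the subcube with free coordinates i ∷ J lies between z
  -- and the vertex of the smaller subcube that differs from z on all of J.
  subcube : ∀ J y → (∀ i → i ∉ₗ J → lookup y i ≡ lookup x i) → y ∈ Hull (Q (suc n)) S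
  subcube [] y agree =
    subst (_∈ Hull _ S) (sym (lookup-ext λ i → agree i λ ())) (base (proj₂ (proj₂ (meets zero true))))
  -- Choosing `z` to agree with `y` at `i` covers both values of `y` there.
  subcube (i ∷ J) y agree with meets i (lookup y i)
  ... | z , zᵢ≡yᵢ , z∈S = Convex-between (Hull-convex (Q (suc n))) u∈Hull (base z∈S) between
    where
    uAt : Fin (suc n) → Bool
    uAt j = if does (j ∈? J) then not (lookup z j) else lookup x j

    u : Vec Bool (suc n)
    u = tabulate uAt

    u∈Hull : u ∈ Hull (Q (suc n)) S
    u∈Hull = subcube J u λ j j∉J → trans (lookup∘tabulate uAt j) (off j j∉J)
      where
      off : ∀ j → j ∉ₗ J → uAt j ≡ lookup x j
      off j j∉J with j ∈? J
      ... | yes j∈J = contradiction j∈J j∉J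
      ... | no _    = refl

    -- Where `y` and `z` differ, `j ∈ J` makes `u` the negation of `z`, hence equal to `y`; outside
    -- `i ∷ J` both `u` and `y` agree with `x`.
    betweenAt : ∀ j → lookup y j ≡ uAt j ⊎ lookup y j ≡ lookup z j
    betweenAt j with j ∈? J | lookup y j ≟ᵇ lookup z j | j ≟ᶠ i
    ... | _       | yes y≡z | _        = inj₂ y≡z
    ... | yes _   | no y≢z  | _        = inj₁ (¬-not y≢z)
    ... | no _    | no y≢z  | yes refl = contradiction (sym zᵢ≡yᵢ) y≢z
    ... | no j∉J  | no _    | no j≢i   =
      inj₁ (agree j λ { (here j≡i) → j≢i j≡i ; (there j∈J) → j∉J j∈J })

    between : ∀ j → lookup y j ≡ lookup u j ⊎ lookup y j ≡ lookup z j
    between j rewrite lookup∘tabulate uAt j = betweenAt j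

allVertices : ∀ n → List (Vec Bool n)
allVertices zero    = [] ∷ []
allVertices (suc n) = List.cartesianProductWith _∷_ (true ∷ false ∷ []) (allVertices n)

∈-allVertices : ∀ {n} (v : Vec Bool n) → v ∈ₗ allVertices n
∈-allVertices []      = here refl
∈-allVertices (b ∷ v) = ∈-cartesianProductWith⁺ _∷_ (∈-bools b) (∈-allVertices v)
  where
  ∈-bools : ∀ b → b ∈ₗ true ∷ false ∷ []
  ∈-bools true  = here refl
  ∈-bools false = there (here refl)

module _ {ℓ n} {S : Pred (Vec Bool n) ℓ} (S? : Decidable S) where

  meetsFacet? : ∀ i c → Dec (∃ λ v → lookup v i ≡ c × v ∈ S)
  meetsFacet? i c = map′
    (λ any → let v , _ , p = find {P = λ v → lookup v i ≡ c × v ∈ S} any in v , p)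
    (λ { (v , p) → lose (∈-allVertices v) p })
    (Any.any? (λ v → (lookup v i ≟ᵇ c) ×-dec S? v) (allVertices n))

  meetsFacets? : Dec (MeetsFacets S)
  meetsFacets? = all? λ i → map′
    (λ { (t , f) true → t ; (t , f) false → f }) (λ m → m true , m false)
    (meetsFacet? i true ×-dec meetsFacet? i false)

  -- If `S` missed a facet, it would lie in the opposite one, which is convex and so contains the
  -- hull; the constant vertex `replicate n c` lies outside it.
  spanning⇒meetsFacets : Hull (Q n) S ≐ U → MeetsFacets S
  spanning⇒meetsFacets (_ , all) i c = decidable-stable (meetsFacet? i c) λ misses →
    not-¬ (lookup-replicate i c)
      (Hull-least (Q n) (Facet-convex i (not c))
        (λ {v} v∈S → ¬-not λ vᵢ≡c → misses (v , vᵢ≡c , v∈S)) (all {replicate n c} tt))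

-- The pairing strategy

_≟ᵛ_ : ∀ {n} → DecidableEquality (Vec Bool n)
_≟ᵛ_ = ≡-dec _≟ᵇ_

mate : ∀ {n} → Vec Bool (suc n) → Vec Bool (suc n)
mate (b ∷ x) = not b ∷ x

mate-involutive : ∀ {n} (v : Vec Bool (suc n)) → mate (mate v) ≡ v
mate-involutive (b ∷ x) = cong (_∷ x) (not-involutive b)

mate-≢ : ∀ {n} (v : Vec Bool (suc n)) → v ≢ mate v
mate-≢ (true ∷ x) ()
mate-≢ (false ∷ x) ()

Symmetric-mate : ∀ {n} → Pred (Pred (Vec Bool (suc n)) 0ℓ) 0ℓ
Symmetric-mate P = ∀ v → v ∈ P → mate v ∈ P

module _ {n} {P : Pred (Vec Bool (suc n)) 0ℓ} (sym-P : Symmetric-mate P) where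

  mate-∉ : ∀ {v} → v ∉ P → mate v ∉ P
  mate-∉ {v} v∉P m∈P = v∉P (subst P (mate-involutive v) (sym-P (mate v) m∈P))

  insert-pair-symmetric : ∀ v → Symmetric-mate ((P ∪ ｛ v ｝) ∪ ｛ mate v ｝)
  insert-pair-symmetric _ w (inj₁ (inj₁ p))    = inj₁ (inj₁ (sym-P w p))
  insert-pair-symmetric _ v (inj₁ (inj₂ refl)) = inj₂ refl
  insert-pair-symmetric v _ (inj₂ refl)        = inj₁ (inj₂ (sym (mate-involutive v)))

-- This makes the reply legal. The unselected vertex already known in the facet still serves unless
-- it is `v` itself.
meetsFacets-insert : ∀ {n} {P : Pred (Vec Bool (2 + n)) 0ℓ} → Symmetric-mate P →
                     MeetsFacets (∁ P) → ∀ {v} → v ∉ P → MeetsFacets (∁ (P ∪ ｛ v ｝))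
meetsFacets-insert {P = P} sym-P meets {v} v∉P i c with meets i c
... | u , uᵢ≡c , u∉P with v ≟ᵛ u
...   | no v≢u = u , uᵢ≡c , λ { (inj₁ p) → u∉P p ; (inj₂ e) → v≢u e }
-- The mate lies in the same facet and is unselected by symmetry.
meetsFacets-insert sym-P meets {b ∷ v} v∉P (suc i) c | _ , vᵢ≡c , _ | yes refl =
  mate (b ∷ v) , vᵢ≡c ,
  λ { (inj₁ p) → mate-∉ sym-P v∉P p ; (inj₂ e) → mate-≢ (b ∷ v) e }
-- Here the mate lies in the opposite facet. Instead, take an unselected vertex with the other
-- second coordinate: it or its mate has first coordinate `c`, and both differ from the inserted
-- vertex.
meetsFacets-insert sym-P meets {b ∷ b′ ∷ v} v∉P zero c | _ , _ , _ | yes refl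
  with meets (suc zero) (not b′)
... | a ∷ a′ ∷ y , refl , y∉P with a ≟ᵇ c
...   | yes a≡c = a ∷ a′ ∷ y , a≡c ,
  λ { (inj₁ p) → y∉P p ; (inj₂ e) → not-¬ refl (cong (λ w → lookup w (suc zero)) e) }
...   | no a≢c = not a ∷ a′ ∷ y , sym (¬-not (a≢c ∘ sym)) ,
  λ { (inj₁ p) → mate-∉ sym-P y∉P p ; (inj₂ e) → not-¬ refl (cong (λ w → lookup w (suc zero)) e) }

-- A positive value would require an option of value 0, but from every option the reply restores
-- symmetry and, by induction, reaches value 0.
symmetric⇒NimValue≡0 : ∀ {n} {P : Pred (Vec Bool (2 + n)) 0ℓ} {k} → Decidable P →
                       Symmetric-mate P → NimValue (TER (Q (2 + n))) P k → k ≡ 0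
symmetric⇒NimValue≡0 {k = zero} _ _ _ = refl
symmetric⇒NimValue≡0 {k = suc _} P? sym-P (mex value correct (_ , below)) with below (s≤s z≤n)
-- Abstracting `value o` together with its derivation lets `value≡0` become `refl`, which yields a
-- derivation of value 0 to refute.
... | _ , o@(select spans {v} v∉P) , value≡0 with value o | correct o
symmetric⇒NimValue≡0 {k = suc _} P? sym-P (mex value correct (_ , below))
    | _ , o@(select spans {v} v∉P) , refl | _ | mex value′ correct′ (0∉ , _) =
  contradiction (_ , reply , reply≡0) 0∉
  where
  reply = select
    (meetsFacets⇒spanning (meetsFacets-insert sym-P (spanning⇒meetsFacets (¬? ∘ P?) spans) v∉P))
    {mate v} λ { (inj₁ p) → mate-∉ sym-P v∉P p ; (inj₂ e) → mate-≢ v e }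

  reply≡0 : value′ reply ≡ 0
  -- The recursion is structural: `correct′ reply` is a subderivation of the given one.
  reply≡0 = symmetric⇒NimValue≡0 ((P? ∪? (v ≟ᵛ_)) ∪? (mate v ≟ᵛ_))
    (insert-pair-symmetric sym-P v) (correct′ reply)

Q-spanning? : ∀ {n} {P : Pred (Vec Bool (suc n)) 0ℓ} → Decidable P →
              Dec (Hull (Q (suc n)) (∁ P) ≐ U)
Q-spanning? P? =
  map′ meetsFacets⇒spanning (spanning⇒meetsFacets (¬? ∘ P?)) (meetsFacets? (¬? ∘ P?))

Q-NimValue-exists : ∀ {n} {P : Pred (Vec Bool (suc n)) 0ℓ} → Decidable P →
                    ∃ (NimValue (TER (Q (suc n))) P)
Q-NimValue-exists = NimValue-exists (Q _) _≟ᵛ_ ∈-allVertices Q-spanning?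

symmetric⇒NimValue-0 : ∀ {n} {P : Pred (Vec Bool (2 + n)) 0ℓ} → Decidable P →
                       Symmetric-mate P → NimValue (TER (Q (2 + n))) P 0
symmetric⇒NimValue-0 {n} {P} P? sym-P = to-0 (Q-NimValue-exists P?)
  where
  to-0 : ∃ (NimValue (TER (Q (2 + n))) P) → NimValue (TER (Q (2 + n))) P 0
  to-0 (_ , nim) = subst (NimValue (TER (Q (2 + n))) P) (symmetric⇒NimValue≡0 P? sym-P nim) nim

proposition5p7 : ∀ (n : ℕ) → n ≥ 3 → GameNimValue (TER (Q n)) 0
-- The empty position is vacuously closed under `mate`.
proposition5p7 (suc (suc n)) (s≤s (s≤s _)) = symmetric⇒NimValue-0 (λ _ → no λ ()) λ _ ()
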